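{- For each integer $a$, the orbit of $\Theta_a$ under $H$ equals $\Gamma_a$, i.e. $\{Mx: M\in H,\ x\in\Theta_a\}=\Gamma_a$.
   Context: For an integer $a$, $\Gamma_a$ is the set of $(x_1,x_2,x_3)\in\mathbb{Z}^3$ (viewed as column vectors) with $x_1^2-2x_2^2+x_3^2=a$. Let $B=\begin{pmatrix}3&4&0\\2&3&0\\0&0&1\end{pmatrix}$, $J=\begin{pmatrix}0&0&1\\0&1&0\\1&0&0\end{pmatrix}$, and let $H$ be the subgroup of $\mathrm{GL}_3(\mathbb{Z})$ generated by $B$ and $J$, acting on $\mathbb{Z}^3$ by left multiplication. Let $\mathcal{C}=\{x\in\mathbb{Z}^3: |x_1|\le|x_2| \text{ or } |x_1|\ge 2|x_2|\}$. Define $\Theta_a=\{x\in\Gamma_a: |x_2|\ge\max\{|x_1|,|x_3|\}\}$ if $a<0$, and $\Theta_a=\{x\in\Gamma_a: x\in\mathcal{C}\text{ and }Jx\in\mathcal{C}\}$ if $a\ge 0$. -}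

module Defs where

open import Data.Integer using (ℤ; +_; -[1+_]; _+_; _*_; -_; _-_; ∣_∣; _≤_; _<_)
open import Data.Nat using (ℕ) renaming (_≤_ to _≤ℕ_; _*_ to _*ℕ_; _⊔_ to _⊔ℕ_)
open import Data.Product using (_×_; _,_; Σ; ∃)
open import Data.Sum using (_⊎_)
open import Relation.Binary.PropositionalEquality using (_≡_)

record V3 : Set where
  constructor v3
  field
    x₁ x₂ x₃ : ℤ
open V3 public

-- 3×3 integer matrices, row-major entries mᵢⱼ
record M3 : Set where
  constructor m3
  field
    m11 m12 m13 m21 m22 m23 m31 m32 m33 : ℤ
open M3 public

_·_ : M3 → V3 → V3
M · v = v3 (m11 M * x₁ v + m12 M * x₂ v + m13 M * x₃ v)
           (m21 M * x₁ v + m22 M * x₂ v + m23 M * x₃ v)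
           (m31 M * x₁ v + m32 M * x₂ v + m33 M * x₃ v)

_⊗_ : M3 → M3 → M3
M ⊗ N = m3
  (m11 M * m11 N + m12 M * m21 N + m13 M * m31 N)
  (m11 M * m12 N + m12 M * m22 N + m13 M * m32 N)
  (m11 M * m13 N + m12 M * m23 N + m13 M * m33 N)
  (m21 M * m11 N + m22 M * m21 N + m23 M * m31 N)
  (m21 M * m12 N + m22 M * m22 N + m23 M * m32 N)
  (m21 M * m13 N + m22 M * m23 N + m23 M * m33 N)
  (m31 M * m11 N + m32 M * m21 N + m33 M * m31 N)
  (m31 M * m12 N + m32 M * m22 N + m33 M * m32 N)
  (m31 M * m13 N + m32 M * m23 N + m33 M * m33 N)

I3 : M3
I3 = m3 (+ 1) (+ 0) (+ 0) (+ 0) (+ 1) (+ 0) (+ 0) (+ 0) (+ 1)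

B : M3
B = m3 (+ 3) (+ 4) (+ 0) (+ 2) (+ 3) (+ 0) (+ 0) (+ 0) (+ 1)

Binv : M3
Binv = m3 (+ 3) (- (+ 4)) (+ 0) (- (+ 2)) (+ 3) (+ 0) (+ 0) (+ 0) (+ 1)

J : M3
J = m3 (+ 0) (+ 0) (+ 1) (+ 0) (+ 1) (+ 0) (+ 1) (+ 0) (+ 0)

-- H = subgroup of GL₃(ℤ) generated by B and J: all finite words in
-- B, B⁻¹, J (= J⁻¹), including the empty word I.
data InH : M3 → Set where
  h-id   : InH I3
  h-B    : ∀ {M} → InH M → InH (B ⊗ M)
  h-Binv : ∀ {M} → InH M → InH (Binv ⊗ M)
  h-J    : ∀ {M} → InH M → InH (J ⊗ M)

Q : V3 → ℤ
Q v = x₁ v * x₁ v - (+ 2) * (x₂ v * x₂ v) + x₃ v * x₃ v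

Γ : ℤ → V3 → Set
Γ a v = Q v ≡ a

InC : V3 → Set
InC v = (∣ x₁ v ∣ ≤ℕ ∣ x₂ v ∣) ⊎ (2 *ℕ ∣ x₂ v ∣ ≤ℕ ∣ x₁ v ∣)

Θ : ℤ → V3 → Set
Θ a@(-[1+ _ ]) v = Γ a v × (∣ x₁ v ∣ ⊔ℕ ∣ x₃ v ∣ ≤ℕ ∣ x₂ v ∣)
Θ a@(+ _)      v = Γ a v × InC v × InC (J · v)

InOrbitΘ : ℤ → V3 → Set
InOrbitΘ a y = Σ M3 λ M → Σ V3 λ x → InH M × Θ a x × (M · x ≡ y)

module Submission where

-- One inclusion is invariance: B, B⁻¹ and J preserve the form
-- Q(x) = x₁² − 2x₂² + x₃², hence so does every M ∈ H.
--
-- The other inclusion is a descent on |x₂|.  If |x₂| < |x₁| < 2|x₂|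
-- (x lies strictly between the two cones making up 𝒞), then one of B⁻¹x,
-- Bx has second coordinate ±(3x₂ − 2x₁) of absolute value < |x₂|; applying
-- the same reasoning to Jx (which swaps x₁ and x₃) covers the second
-- condition defining Θ_a.  For a < 0 the form is ≥ 0 on the cone
-- 2|x₂| ≤ |x₁|, so a negative value forces |x₁| < 2|x₂|, and the two
-- conditions of Θ_a reduce to the same dichotomy.  Thus every x ∈ Γ_a is
-- in Θ_a or has a neighbour under a generator with smaller |x₂|; well-founded
-- induction on |x₂| then puts x into the orbit of Θ_a.

open import Defs
open import Data.Integer using (ℤ)
open import Data.Product using (_×_)

open import Data.Integer using (+_; -[1+_]; _+_; _*_; -_; _-_; ∣_∣; _⊖_; 0ℤ; +≤+)
  renaming (_≤_ to _≤ℤ_)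
open import Data.Integer.Properties using (pos-*; pos-+; m-n≡m⊖n; ⊖-≥; ∣⊖∣-≤; ∣m⊖n∣≡∣n⊖m∣; ∣-i∣≡∣i∣)
open import Data.Integer.Tactic.RingSolver using (solve-∀)
open import Data.Nat using (suc; z≤n; _≤?_)
  renaming (_≤_ to _≤ℕ_; _<_ to _<ℕ_; _*_ to _*ℕ_; _+_ to _+ℕ_; _∸_ to _∸ℕ_)
open import Data.Nat.Properties
  using (≤-total; ≤-trans; ≰⇒>; ⊔-lub; m≤m+n; m+n∸m≡n; ∸-monoˡ-<; +-monoˡ-<; *-monoʳ-<; *-mono-≤)
open import Data.Nat.Induction using (<-wellFounded)
import Data.Nat.Tactic.RingSolver as ℕSolver
open import Data.Product using (Σ; _,_)
open import Data.Sum using (_⊎_; inj₁; inj₂)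
open import Function using (_∘_)
open import Induction.WellFounded using (WellFounded; Acc; acc)
import Relation.Binary.Construct.On as On
open import Relation.Nullary using (yes; no; ¬_)
open import Relation.Binary.PropositionalEquality using (_≡_; refl; sym; trans; cong; cong₂; subst; module ≡-Reasoning)

cong₃ : ∀ {A B C D : Set} (f : A → B → C → D) {a a′ b b′ c c′} →
        a ≡ a′ → b ≡ b′ → c ≡ c′ → f a b c ≡ f a′ b′ c′
cong₃ f refl refl refl = refl

·-assoc : ∀ M N w → (M ⊗ N) · w ≡ M · (N · w)
·-assoc M N w = cong₃ v3 (row (m11 M) (m12 M) (m13 M)) (row (m21 M) (m22 M) (m23 M)) (row (m31 M) (m32 M) (m33 M))
  where
  row-identity : ∀ (a b c a′ b′ c′ d′ e′ f′ g′ h′ i′ x y z : ℤ) →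
    (a * a′ + b * d′ + c * g′) * x + (a * b′ + b * e′ + c * h′) * y + (a * c′ + b * f′ + c * i′) * z
    ≡ a * (a′ * x + b′ * y + c′ * z) + b * (d′ * x + e′ * y + f′ * z) + c * (g′ * x + h′ * y + i′ * z)
  row-identity = solve-∀
  row : ∀ a b c →
    (a * m11 N + b * m21 N + c * m31 N) * x₁ w + (a * m12 N + b * m22 N + c * m32 N) * x₂ w
      + (a * m13 N + b * m23 N + c * m33 N) * x₃ w
    ≡ a * x₁ (N · w) + b * x₂ (N · w) + c * x₃ (N · w)
  row a b c = row-identity a b c (m11 N) (m12 N) (m13 N) (m21 N) (m22 N) (m23 N) (m31 N) (m32 N) (m33 N) (x₁ w) (x₂ w) (x₃ w)

I3-identity : ∀ w → I3 · w ≡ w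
I3-identity (v3 x y z) = cong₃ v3 (first x y z) (second x y z) (third x y z)
  where
  first : ∀ x y z → + 1 * x + + 0 * y + + 0 * z ≡ x
  first = solve-∀
  second : ∀ x y z → + 0 * x + + 1 * y + + 0 * z ≡ y
  second = solve-∀
  third : ∀ x y z → + 0 * x + + 0 * y + + 1 * z ≡ z
  third = solve-∀

cancel : ∀ {M N} → M ⊗ N ≡ I3 → ∀ w → M · (N · w) ≡ w
cancel {M} {N} MN≡I w = begin
  M · (N · w)   ≡⟨ sym (·-assoc M N w) ⟩
  (M ⊗ N) · w   ≡⟨ cong (_· w) MN≡I ⟩
  I3 · w        ≡⟨ I3-identity w ⟩
  w             ∎
  where open ≡-Reasoning

J-swap : ∀ w → J · w ≡ v3 (x₃ w) (x₂ w) (x₁ w)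
J-swap (v3 x y z) = cong₃ v3 (first x y z) (second x y z) (third x y z)
  where
  first : ∀ x y z → + 0 * x + + 0 * y + + 1 * z ≡ z
  first = solve-∀
  second : ∀ x y z → + 0 * x + + 1 * y + + 0 * z ≡ y
  second = solve-∀
  third : ∀ x y z → + 1 * x + + 0 * y + + 0 * z ≡ x
  third = solve-∀

Q-B : ∀ v → Q (B · v) ≡ Q v
Q-B (v3 x y z) = identity x y z
  where
  identity : ∀ x y z →
    let x′ = + 3 * x + + 4 * y + + 0 * z
        y′ = + 2 * x + + 3 * y + + 0 * z
        z′ = + 0 * x + + 0 * y + + 1 * z
    in x′ * x′ - + 2 * (y′ * y′) + z′ * z′ ≡ x * x - + 2 * (y * y) + z * z
  identity = solve-∀

Q-Binv : ∀ v → Q (Binv · v) ≡ Q v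
Q-Binv (v3 x y z) = identity x y z
  where
  identity : ∀ x y z →
    let x′ = + 3 * x + - (+ 4) * y + + 0 * z
        y′ = - (+ 2) * x + + 3 * y + + 0 * z
        z′ = + 0 * x + + 0 * y + + 1 * z
    in x′ * x′ - + 2 * (y′ * y′) + z′ * z′ ≡ x * x - + 2 * (y * y) + z * z
  identity = solve-∀

Q-J : ∀ v → Q (J · v) ≡ Q v
Q-J v = trans (cong Q (J-swap v)) (identity (x₁ v) (x₂ v) (x₃ v))
  where
  identity : ∀ x y z → z * z - + 2 * (y * y) + x * x ≡ x * x - + 2 * (y * y) + z * z
  identity = solve-∀

Q-compose : ∀ G M → (∀ v → Q (G · v) ≡ Q v) → (∀ v → Q (M · v) ≡ Q v) → ∀ v → Q ((G ⊗ M) · v) ≡ Q v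
Q-compose G M Q-G Q-M v = trans (cong Q (·-assoc G M v)) (trans (Q-G (M · v)) (Q-M v))

Q-invariant : ∀ {M} → InH M → ∀ v → Q (M · v) ≡ Q v
Q-invariant h-id           v = cong Q (I3-identity v)
Q-invariant (h-B {M} h)    = Q-compose B M Q-B (Q-invariant h)
Q-invariant (h-Binv {M} h) = Q-compose Binv M Q-Binv (Q-invariant h)
Q-invariant (h-J {M} h)    = Q-compose J M Q-J (Q-invariant h)

Θ⊆Γ : ∀ a x → Θ a x → Γ a x
Θ⊆Γ (+ _) x (q , _) = q
Θ⊆Γ -[1+ _ ] x (q , _) = q

Θ⊆orbit : ∀ a x → Θ a x → InOrbitΘ a x
Θ⊆orbit a x θ = I3 , x , h-id , θ , I3-identity x

orbit⊆Γ : ∀ a y → InOrbitΘ a y → Γ a y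
orbit⊆Γ a y (M , x , h , θ , Mx≡y) = trans (cong Q (sym Mx≡y)) (trans (Q-invariant h x) (Θ⊆Γ a x θ))

orbit-pullback : ∀ {a} G G′ → (∀ {M} → InH M → InH (G′ ⊗ M)) → G′ ⊗ G ≡ I3 →
                 ∀ y → InOrbitΘ a (G · y) → InOrbitΘ a y
orbit-pullback G G′ gen G′G≡I y (M , x , h , θ , Mx≡Gy) =
  G′ ⊗ M , x , gen h , θ , trans (·-assoc G′ M x) (trans (cong (G′ ·_) Mx≡Gy) (cancel {G′} {G} G′G≡I y))

∸-below : ∀ {m n c} → m ≤ℕ n → n <ℕ m +ℕ c → n ∸ℕ m <ℕ c
∸-below {m} {n} {c} m≤n n<m+c = subst (n ∸ℕ m <ℕ_) (m+n∸m≡n m c) (∸-monoˡ-< n<m+c m≤n)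

⊖-within : ∀ a b c → a <ℕ b +ℕ c → b <ℕ a +ℕ c → ∣ a ⊖ b ∣ <ℕ c
⊖-within a b c a<b+c b<a+c with ≤-total a b
... | inj₁ a≤b = subst (_<ℕ c) (sym (∣⊖∣-≤ a≤b)) (∸-below a≤b b<a+c)
... | inj₂ b≤a = subst (_<ℕ c) (sym (trans (∣m⊖n∣≡∣n⊖m∣ a b) (∣⊖∣-≤ b≤a))) (∸-below b≤a a<b+c)

-- δ u v = 3v − 2u is the second coordinate of B⁻¹(u, v, w); the second
-- coordinate of B(u, v, w) is δ (−u) v.
δ : ℤ → ℤ → ℤ
δ u v = + 3 * v - + 2 * u

δ-shrinks-ℕ : ∀ m n → n <ℕ m → m <ℕ 2 *ℕ n → ∣ δ (+ m) (+ n) ∣ <ℕ n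
δ-shrinks-ℕ m n n<m m<2n = subst (_<ℕ n) (cong ∣_∣ (sym δ≡⊖)) (⊖-within (3 *ℕ n) (2 *ℕ m) n 3n<2m+n 2m<3n+n)
  where
  δ≡⊖ : δ (+ m) (+ n) ≡ 3 *ℕ n ⊖ 2 *ℕ m
  δ≡⊖ = trans (cong₂ _-_ (sym (pos-* 3 n)) (sym (pos-* 2 m))) (m-n≡m⊖n (3 *ℕ n) (2 *ℕ m))
  3n<2m+n : 3 *ℕ n <ℕ 2 *ℕ m +ℕ n
  3n<2m+n = subst (_<ℕ 2 *ℕ m +ℕ n) (three n) (+-monoˡ-< n (*-monoʳ-< 2 n<m))
    where
    three : ∀ k → 2 *ℕ k +ℕ k ≡ 3 *ℕ k
    three = ℕSolver.solve-∀
  2m<3n+n : 2 *ℕ m <ℕ 3 *ℕ n +ℕ n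
  2m<3n+n = subst (2 *ℕ m <ℕ_) (four n) (*-monoʳ-< 2 m<2n)
    where
    four : ∀ k → 2 *ℕ (2 *ℕ k) ≡ 3 *ℕ k +ℕ k
    four = ℕSolver.solve-∀

∣δ-neg∣ : ∀ u v → ∣ δ (- u) (- v) ∣ ≡ ∣ δ u v ∣
∣δ-neg∣ u v = trans (cong ∣_∣ (negation u v)) (∣-i∣≡∣i∣ (δ u v))
  where
  negation : ∀ u v → + 3 * (- v) - + 2 * (- u) ≡ - (+ 3 * v - + 2 * u)
  negation = solve-∀

-- If |v| < |u| < 2|v| then one of |3v − 2u|, |3v + 2u| is < |v|:
-- the first when u, v have the same sign, the second otherwise.
δ-shrinks : ∀ u v → ∣ v ∣ <ℕ ∣ u ∣ → ∣ u ∣ <ℕ 2 *ℕ ∣ v ∣ → ∣ δ u v ∣ <ℕ ∣ v ∣ ⊎ ∣ δ (- u) v ∣ <ℕ ∣ v ∣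
δ-shrinks (+ m)    (+ n)    h₁ h₂ = inj₁ (δ-shrinks-ℕ m n h₁ h₂)
δ-shrinks -[1+ m ] (+ n)    h₁ h₂ = inj₂ (δ-shrinks-ℕ (suc m) n h₁ h₂)
δ-shrinks -[1+ m ] -[1+ n ] h₁ h₂ =
  inj₁ (subst (_<ℕ suc n) (sym (∣δ-neg∣ (+ suc m) (+ suc n))) (δ-shrinks-ℕ (suc m) (suc n) h₁ h₂))
δ-shrinks (+ m)    -[1+ n ] h₁ h₂ =
  inj₂ (subst (_<ℕ suc n) (sym (∣δ-neg∣ (+ m) (+ suc n))) (δ-shrinks-ℕ m (suc n) h₁ h₂))

x₂-Binv : ∀ w → x₂ (Binv · w) ≡ δ (x₁ w) (x₂ w)
x₂-Binv (v3 x y z) = identity x y z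
  where
  identity : ∀ x y z → - (+ 2) * x + + 3 * y + + 0 * z ≡ + 3 * y - + 2 * x
  identity = solve-∀

x₂-B : ∀ w → x₂ (B · w) ≡ δ (- x₁ w) (x₂ w)
x₂-B (v3 x y z) = identity x y z
  where
  identity : ∀ x y z → + 2 * x + + 3 * y + + 0 * z ≡ + 3 * y - + 2 * (- x)
  identity = solve-∀

square : ∀ i → i * i ≡ + (∣ i ∣ *ℕ ∣ i ∣)
square (+ n)    = sym (pos-* n n)
square -[1+ n ] = refl

-- Q is nonnegative on the wide cone 2|x₂| ≤ |x₁|, because there
-- x₁² ≥ 4x₂² ≥ 2x₂².
wide⇒Q≥0 : ∀ y → 2 *ℕ ∣ x₂ y ∣ ≤ℕ ∣ x₁ y ∣ → 0ℤ ≤ℤ Q y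
wide⇒Q≥0 y 2C≤A = subst (0ℤ ≤ℤ_) (sym Q≡) (+≤+ z≤n)
  where
  A = ∣ x₁ y ∣
  C = ∣ x₂ y ∣
  D = ∣ x₃ y ∣
  2C²≤A² : 2 *ℕ (C *ℕ C) ≤ℕ A *ℕ A
  2C²≤A² = ≤-trans (subst (2 *ℕ (C *ℕ C) ≤ℕ_) (double C) (m≤m+n _ _)) (*-mono-≤ 2C≤A 2C≤A)
    where
    double : ∀ c → 2 *ℕ (c *ℕ c) +ℕ 2 *ℕ (c *ℕ c) ≡ (2 *ℕ c) *ℕ (2 *ℕ c)
    double = ℕSolver.solve-∀
  open ≡-Reasoning
  Q≡ : Q y ≡ + (A *ℕ A ∸ℕ 2 *ℕ (C *ℕ C) +ℕ D *ℕ D)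
  Q≡ = begin
    x₁ y * x₁ y - + 2 * (x₂ y * x₂ y) + x₃ y * x₃ y
      ≡⟨ cong₃ (λ p q r → p - + 2 * q + r) (square (x₁ y)) (square (x₂ y)) (square (x₃ y)) ⟩
    + (A *ℕ A) - + 2 * + (C *ℕ C) + + (D *ℕ D)
      ≡⟨ cong (λ q → + (A *ℕ A) - q + + (D *ℕ D)) (sym (pos-* 2 (C *ℕ C))) ⟩
    + (A *ℕ A) - + (2 *ℕ (C *ℕ C)) + + (D *ℕ D)
      ≡⟨ cong (_+ + (D *ℕ D)) (trans (m-n≡m⊖n (A *ℕ A) (2 *ℕ (C *ℕ C))) (⊖-≥ 2C²≤A²)) ⟩
    + (A *ℕ A ∸ℕ 2 *ℕ (C *ℕ C)) + + (D *ℕ D)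
      ≡⟨ sym (pos-+ (A *ℕ A ∸ℕ 2 *ℕ (C *ℕ C)) (D *ℕ D)) ⟩
    + (A *ℕ A ∸ℕ 2 *ℕ (C *ℕ C) +ℕ D *ℕ D)
      ∎

negative⇒narrow : ∀ y n → Q y ≡ -[1+ n ] → ∣ x₁ y ∣ <ℕ 2 *ℕ ∣ x₂ y ∣
negative⇒narrow y n q = ≰⇒> λ wide → absurd (subst (0ℤ ≤ℤ_) q (wide⇒Q≥0 y wide))
  where
  absurd : ¬ (0ℤ ≤ℤ -[1+ n ])
  absurd ()

Middle : V3 → Set
Middle y = (∣ x₂ y ∣ <ℕ ∣ x₁ y ∣) × (∣ x₁ y ∣ <ℕ 2 *ℕ ∣ x₂ y ∣)

InC-or-Middle : ∀ y → InC y ⊎ Middle y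
InC-or-Middle y with ∣ x₁ y ∣ ≤? ∣ x₂ y ∣ | 2 *ℕ ∣ x₂ y ∣ ≤? ∣ x₁ y ∣
... | yes narrow | _        = inj₁ (inj₁ narrow)
... | no _       | yes wide = inj₁ (inj₂ wide)
... | no p       | no q     = inj₂ (≰⇒> p , ≰⇒> q)

_≺_ : V3 → V3 → Set
z ≺ y = ∣ x₂ z ∣ <ℕ ∣ x₂ y ∣

≺-wellFounded : WellFounded _≺_
≺-wellFounded = On.wellFounded (∣_∣ ∘ x₂) <-wellFounded

Descent : ℤ → V3 → Set
Descent a y = Σ V3 λ z → z ≺ y × Q z ≡ Q y × (InOrbitΘ a z → InOrbitΘ a y)

middle-descends : ∀ a y → Middle y → Descent a y
middle-descends a y (h₁ , h₂) with δ-shrinks (x₁ y) (x₂ y) h₁ h₂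
... | inj₁ lt = Binv · y , subst (λ t → ∣ t ∣ <ℕ ∣ x₂ y ∣) (sym (x₂-Binv y)) lt , Q-Binv y ,
                orbit-pullback Binv B h-B refl y
... | inj₂ lt = B · y , subst (λ t → ∣ t ∣ <ℕ ∣ x₂ y ∣) (sym (x₂-B y)) lt , Q-B y ,
                orbit-pullback B Binv h-Binv refl y

-- J fixes x₂ and Q and is an involution, so descents of J·y are descents of y.
descent-via-J : ∀ a y → Descent a (J · y) → Descent a y
descent-via-J a y (z , z≺Jy , Qz , pull) =
  z , subst (λ w → z ≺ w) (J-swap y) z≺Jy , trans Qz (Q-J y) , orbit-pullback J J h-J refl y ∘ pull

Θ-or-descent : ∀ a y → Γ a y → Θ a y ⊎ Descent a y
Θ-or-descent (+ n) y q with InC-or-Middle y | InC-or-Middle (J · y)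
... | inj₂ middle | _            = inj₂ (middle-descends (+ n) y middle)
... | inj₁ c      | inj₁ c′      = inj₁ (q , c , c′)
... | inj₁ _      | inj₂ middle′ = inj₂ (descent-via-J (+ n) y (middle-descends (+ n) (J · y) middle′))
Θ-or-descent a@(-[1+ n ]) y q with ∣ x₁ y ∣ ≤? ∣ x₂ y ∣ | ∣ x₃ y ∣ ≤? ∣ x₂ y ∣
... | no p   | _      = inj₂ (middle-descends a y (≰⇒> p , negative⇒narrow y n q))
... | yes p₁ | yes p₃ = inj₁ (q , ⊔-lub p₁ p₃)
... | yes _  | no p₃  = inj₂ (descent-via-J a y (middle-descends a (J · y) Jy-middle))
  where
  Jy-middle : Middle (J · y)
  Jy-middle = subst (λ w → ∣ x₂ w ∣ <ℕ ∣ x₁ w ∣) (sym (J-swap y)) (≰⇒> p₃) ,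
              negative⇒narrow (J · y) n (trans (Q-J y) q)

Γ⊆orbit : ∀ a y → Acc _≺_ y → Γ a y → InOrbitΘ a y
Γ⊆orbit a y (acc smaller) q with Θ-or-descent a y q
... | inj₁ θ                     = Θ⊆orbit a y θ
... | inj₂ (z , z≺y , Qz , pull) = pull (Γ⊆orbit a z (smaller z≺y) (trans Qz q))

theorem1p3 : (a : ℤ) → (∀ y → InOrbitΘ a y → Γ a y) × (∀ y → Γ a y → InOrbitΘ a y)
theorem1p3 a = orbit⊆Γ a , λ y → Γ⊆orbit a y (≺-wellFounded y)
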